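{- Every polyomino $P$ is $C_4$-face-magic. That is, for every polyomino $P$, identified with its associated plane graph with vertex set $V(P)$, there exist a bijection $f: V(P)\to\{1,2,\dots,|V(P)|\}$ and a constant $c$ such that for every face $F$ of $P$ with $F\cong C_4$, the sum of the labels $f(v)$ over the four vertices $v$ of the bounding $4$-cycle equals $c$.
   Context: A polyomino is a finite edge-connected union of unit squares (cells) in the square lattice $\mathbb{Z}^2$: the cells are unit squares with corners in $\mathbb{Z}^2$, there are finitely many (and at least one), and any two cells are joined by a sequence of cells in which consecutive cells share a lattice edge. A polyomino is identified with its associated plane graph, whose vertices are the lattice points that are corners of its cells and whose edges are the unit lattice edges that are sides of its cells. Polyominoes are not assumed to be simply connected: they may have holes, in which case bounded faces other than the cells may occur. For a planar graph $G=(V,E)$ embedded in $\mathbb{R}^2$, let $\mathcal{F}(G)$ denote its set of faces. $G$ is called $C_n$-face-magic if there exist a bijection $f: V(G)\to\{1,2,\dots,|V(G)|\}$ and a constant $c$ such that for every $F\in\mathcal{F}(G)$ with $F\cong C_n$ (i.e. the face is bounded by a cycle with $n$ vertices), the sum of all the vertex labels along that cycle equals $c$. -}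

module Defs where

open import Data.Fin.Base using (Fin; toℕ)
open import Data.Integer.Base as ℤ using (ℤ)
import Data.Integer.Properties as ℤ
open import Data.List.Base using (List; []; _∷_; concatMap; deduplicate; length; tabulate)
open import Data.List.Membership.Propositional using (_∈_; _∉_)
open import Data.Nat.Base using (ℕ; suc; NonZero; _≤_)
open import Data.Nat.DivMod using (_mod_)
open import Data.Nat.ListAction using (sum)
open import Data.Product.Base using (_×_; _,_; ∃-syntax)
open import Data.Product.Properties using (≡-dec)
open import Data.Refinement using (Refinement-syntax; value)
open import Data.Sum.Base using (_⊎_)
open import Function.Bundles using (_⤖_; _⇔_; Bijection)
open import Function.Definitions using (Injective)
open import Relation.Binary.Construct.Closure.ReflexiveTransitive using (Star)
open import Relation.Binary.Definitions using (DecidableEquality)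
open import Relation.Binary.PropositionalEquality using (_≡_; _≢_)

Point : Set
Point = ℤ × ℤ

_≟ₚ_ : DecidableEquality Point
_≟ₚ_ = ≡-dec ℤ._≟_ ℤ._≟_

right up : Point → Point
right (x , y) = ℤ.suc x , y
up    (x , y) = x , ℤ.suc y

-- A unit edge is given by its left (hor) or lower (ver) endpoint.
data Edge : Set where
  hor ver : Point → Edge

endpoints : Edge → Point × Point
endpoints (hor p) = p , right p
endpoints (ver p) = p , up p

Joins : Edge → Point → Point → Set
Joins e p q = endpoints e ≡ (p , q) ⊎ endpoints e ≡ (q , p)

-- A unit square with corners in ℤ², given by its lower left corner.
data Square : Set where
  sq : Point → Square

corners : Square → List Point
corners (sq p) = p ∷ right p ∷ right (up p) ∷ up p ∷ []

sides : Square → List Edge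
sides (sq p) = hor p ∷ ver (right p) ∷ hor (up p) ∷ ver p ∷ []

-- The finite set of cells is the set of members of a list; the order and
-- repetitions of the list play no role below.
record Polyomino : Set where
  field
    cells     : List Square
    nonempty  : cells ≢ []

  EdgeAdjacent : Square → Square → Set
  EdgeAdjacent s t = s ∈ cells × t ∈ cells × ∃[ e ] (e ∈ sides s × e ∈ sides t)

  field
    connected : ∀ {s t} → s ∈ cells → t ∈ cells → Star EdgeAdjacent s t

  vertices : List Point
  vertices = deduplicate _≟ₚ_ (concatMap corners cells)

  edges : List Edge
  edges = concatMap sides cells

open Polyomino public using (vertices; edges)

Vertex : Polyomino → Set
Vertex P = [ p ∈ Point ∣ p ∈ vertices P ]

∣V_∣ : Polyomino → ℕ
∣V P ∣ = length (vertices P)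

-- The set {1, 2, …, N}.
Label : ℕ → Set
Label N = [ k ∈ ℕ ∣ 1 ≤ k × k ≤ N ]

-- Faces of the plane graph.  A face is a connected component of the plane
-- minus the graph.  It contains the interior of some unit square, and two
-- open unit squares lie in the same face exactly when one can pass between
-- them by crossing unit edges that do not belong to the graph (a lattice
-- point outside the graph lies on no edge of the graph, so passing through
-- such a point gives nothing more).  A face is therefore represented by any
-- unit square s contained in it.  This covers every face: cells, faces
-- inside holes, and the unbounded face.
module _ (P : Polyomino) where

  Crossing : Square → Square → Set
  Crossing s t = ∃[ e ] (e ∉ edges P × e ∈ sides s × e ∈ sides t)

  SameFace : Square → Square → Set
  SameFace = Star Crossing

  OnBoundary : Square → Edge → Set
  OnBoundary s e = e ∈ edges P × ∃[ t ] (SameFace s t × e ∈ sides t)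

next : ∀ {n} .{{_ : NonZero n}} → Fin n → Fin n
next {n} i = suc (toℕ i) mod n

record IsCycle (P : Polyomino) (n : ℕ) .{{_ : NonZero n}}
               (γ : Fin n → Vertex P) : Set where
  field
    3≤n       : 3 ≤ n
    injective : Injective _≡_ _≡_ γ
    adjacent  : ∀ i → ∃[ e ] (e ∈ edges P × Joins e (value (γ i)) (value (γ (next i))))

-- The boundary of the face of s is exactly the n-cycle γ.  Every vertex of
-- the graph lies on an edge, so it is enough to compare edges.
record BoundedBy (P : Polyomino) (s : Square) (n : ℕ) .{{_ : NonZero n}}
                 (γ : Fin n → Vertex P) : Set where
  field
    isCycle  : IsCycle P n γ
    boundary : ∀ e → OnBoundary P s e ⇔
                     (∃[ i ] Joins e (value (γ i)) (value (γ (next i))))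

C[_]-FaceMagic : (n : ℕ) .{{_ : NonZero n}} → Polyomino → Set
C[ n ]-FaceMagic P =
  ∃[ f ] ∃[ c ] ∀ (s : Square) (γ : Fin n → Vertex P) → BoundedBy P s n γ →
    sum (tabulate (λ i → label f (γ i))) ≡ c
  where
  label : Vertex P ⤖ Label ∣V P ∣ → Vertex P → ℕ
  label f v = value (Bijection.to f v)

{-# OPTIONS --safe #-}

-- A labelling whose sums over horizontal unit edges depend only on the colour of the left
-- endpoint in the checkerboard colouring has constant sums over unit squares.  Cut the vertex
-- set into maximal horizontal runs and list the runs one after another, each forwards or
-- backwards.  If the positions can be matched with the colours, the labels 1, N, 2, N − 1, 3, …
-- work: their consecutive sums alternate between N + 1 and N + 2.  An even run fits positions
-- of one parity only, an odd run fits in one of its two directions and switches the parity for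
-- the next run.  So one odd run suffices: even runs of one kind, the odd run, even runs of the
-- other kind, remaining odd runs.  By symmetry one odd vertical run suffices as well.
--
-- If all horizontal and all vertical runs are even, then Σ (-1)^(x+y) x vanishes, as is seen
-- along the vertical runs; along the horizontal runs, twice this sum is the difference of the
-- numbers of points in the two kinds of even runs.  Both kinds thus contain N / 2 points, and
-- they receive the labels 1, N − 1, 3, N − 3, … and N, 2, N − 2, 4, … respectively, whose
-- consecutive sums alternate between N and N + 2.

module Submission where

open import Data.Fin.Base using (Fin)
open import Data.Fin.Patterns using (0F; 1F; 2F; 3F)
open import Data.Integer.Base as ℤ using (ℤ; +_; -[1+_]; ∣_∣)
import Data.Integer.Properties as ℤ
import Data.Integer.Solver as ℤ
open import Data.Irrelevant using ([_])
open import Data.List.Base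
  using (List; []; _∷_; _++_; _∷ʳ_; applyUpTo; concatMap; foldr; length; map; tabulate)
open import Data.List.Membership.Propositional using (_∈_; _∉_)
open import Data.List.Membership.Propositional.Properties
  using (∈-++⁺ˡ; ∈-++⁺ʳ; ∈-++⁻; ∈-∃++; ∈-map⁺; ∈-map⁻; ∈-applyUpTo⁺)
open import Data.List.Properties
  using (++-identityʳ; concatMap-++; length-++; length-applyUpTo; length-map)
open import Data.List.Relation.Binary.Permutation.Propositional as ↭
  using (_↭_; prep; ↭-refl; ↭-reflexive; ↭-sym; ↭-trans; ↭⇒↭ₛ)
open import Data.List.Relation.Binary.Permutation.Propositional.Properties
  using (All-resp-↭; ∈-resp-↭; ↭-length; map⁺; ++⁺; ++⁺ˡ; shift; shifts; ∷↭∷ʳ)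
import Data.List.Relation.Binary.Permutation.Setoid.Properties as ↭ₛ
open import Data.List.Relation.Unary.All as All using (All; []; _∷_)
import Data.List.Relation.Unary.All.Properties as All
open import Data.List.Relation.Unary.AllPairs using (AllPairs; []; _∷_)
open import Data.List.Relation.Unary.Any using (here; there)
open import Data.List.Relation.Unary.Linked.Properties using (Linked⇒AllPairs)
open import Data.List.Relation.Unary.Unique.Propositional using (Unique)
import Data.List.Relation.Unary.Unique.Propositional.Properties as Unique
import Data.List.Sort
open import Data.Nat.Base as ℕ
  using (ℕ; zero; suc; nonZero; parity; _∸_; _<_; _≤_; ⌊_/2⌋; s<s; s≤s; z<s; z≤n)
open import Data.Nat.ListAction using (sum)
import Data.Nat.Properties as ℕ
import Data.Nat.Solver as ℕ
open import Data.Parity.Base as ℙ using (Parity; 0ℙ; 1ℙ; _⁻¹)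
import Data.Parity.Properties as ℙ
open import Data.Product.Base using (_×_; _,_; ∃₂; ∃-syntax; proj₁; proj₂; swap; uncurry)
open import Data.Refinement using (value; _,_)
open import Data.Refinement.Properties using (value-injective)
open import Data.Sum.Base as Sum using (_⊎_; inj₁; inj₂)
open import Function.Base using (_∘_)
open import Function.Bundles using (mk⤖)
import Relation.Binary.Construct.On as On
open import Relation.Binary.PropositionalEquality hiding ([_])
open import Relation.Nullary using (¬_; contradiction; no; yes)
open import Relation.Nullary.Decidable using (recompute)
open import Defs
open import Data.List.Membership.DecPropositional _≟ₚ_ using (_∈?_)
open import Data.List.Membership.DecPropositional ℕ._≟_ using () renaming (_∈?_ to _∈ℕ?_)
open import Data.List.Relation.Unary.Unique.DecPropositional.Properties _≟ₚ_ using (deduplicate-!)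

Unique-resp-↭ : ∀ {A : Set} {xs ys : List A} → xs ↭ ys → Unique xs → Unique ys
Unique-resp-↭ p = ↭ₛ.Unique-resp-↭ (setoid _) (↭⇒↭ₛ p)

-- Horizontal runs

Run : Set
Run = Point × ℕ

segment : Point → ℕ → List Point
segment p zero    = []
segment p (suc n) = p ∷ segment (right p) n

points : List Run → List Point
points = concatMap (uncurry segment)

-- The left endpoints of the unit edges inside `segment p n`: all of its points but the last.
data Inner : Point → ℕ → Point → Set where
  here  : ∀ {p n} → Inner p (suc (suc n)) p
  there : ∀ {p n u} → Inner (right p) n u → Inner p (suc n) u

Linked : List Run → Point → Set
Linked rs u = ∃₂ λ p n → (p , n) ∈ rs × Inner p n u

-- The field `linked` encodes maximality of the runs: every horizontal unit edge between points of
-- `V` lies inside one run.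
record Runs (V : List Point) : Set where
  field
    runs   : List Run
    perm   : V ↭ points runs
    linked : ∀ {u} → u ∈ V → right u ∈ V → Linked runs u

points-↭ : ∀ {rs ss} → rs ↭ ss → points rs ↭ points ss
points-↭ ↭.refl         = ↭-refl
points-↭ (prep r p)     = ++⁺ˡ _ (points-↭ p)
points-↭ (↭.swap r s p) = ↭-trans (shifts (uncurry segment r) (uncurry segment s))
  (++⁺ˡ (uncurry segment s) (++⁺ˡ (uncurry segment r) (points-↭ p)))
points-↭ (↭.trans p q)  = ↭-trans (points-↭ p) (points-↭ q)

Runs-resp-↭ : ∀ {V W} → V ↭ W → Runs V → Runs W
Runs-resp-↭ p R = record
  { runs   = runs
  ; perm   = ↭-trans (↭-sym p) perm
  ; linked = λ u∈ r∈ → linked (∈-resp-↭ (↭-sym p) u∈) (∈-resp-↭ (↭-sym p) r∈)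
  } where open Runs R

reorder : ∀ {V rs} (R : Runs V) → Runs.runs R ↭ rs → Runs V
reorder {rs = rs} R p = record
  { runs   = rs
  ; perm   = ↭-trans perm (points-↭ p)
  ; linked = λ u∈ r∈ → let (p′ , n , r∈rs , i) = linked u∈ r∈ in p′ , n , ∈-resp-↭ p r∈rs , i
  } where open Runs R

∈-run : ∀ {u} rs → u ∈ points rs → ∃₂ λ p n → (p , n) ∈ rs × u ∈ segment p n
∈-run ((p , n) ∷ rs) u∈ with ∈-++⁻ (segment p n) u∈
... | inj₁ u∈s = p , n , here refl , u∈s
... | inj₂ u∈rs = let (q , m , r∈ , u∈s) = ∈-run rs u∈rs in q , m , there r∈ , u∈s

segment⊆points : ∀ {u p n rs} → (p , n) ∈ rs → u ∈ segment p n → u ∈ points rs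
segment⊆points (here refl) u∈ = ∈-++⁺ˡ u∈
segment⊆points {rs = (q , m) ∷ _} (there r∈) u∈ = ∈-++⁺ʳ (segment q m) (segment⊆points r∈ u∈)

suc-injective : ∀ {i j} → ℤ.suc i ≡ ℤ.suc j → i ≡ j
suc-injective {i} {j} e = trans (sym (ℤ.pred-suc i)) (trans (cong ℤ.pred e) (ℤ.pred-suc j))

right-injective : ∀ {p q} → right p ≡ right q → p ≡ q
right-injective {_ , _} {_ , _} e = cong₂ _,_ (suc-injective (cong proj₁ e)) (cong proj₂ e)

right∈segment : ∀ {p q} n → right p ∈ segment q n → right p ≡ q ⊎ p ∈ segment q n
right∈segment (suc n) (here e) = inj₁ e
right∈segment (suc n) (there r∈) with right∈segment n r∈
... | inj₁ e  = inj₂ (here (right-injective e))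
... | inj₂ p∈ = inj₂ (there p∈)

right≰ : ∀ {p} → ¬ (proj₁ (right p) ℤ.≤ proj₁ p)
right≰ {x , _} = ℤ.<⇒≱ (ℤ.suc[i]≤j⇒i<j ℤ.≤-refl)

extract : ∀ {A : Set} {x : A} {xs} → x ∈ xs → ∃[ ys ] (xs ↭ x ∷ ys)
extract x∈ with ys , zs , refl ← ∈-∃++ x∈ = ys ++ zs , shift _ ys zs

-- Adding a leftmost point either starts a new run or extends a run on its left.
extend : ∀ {p V} → p ∉ V → All (λ v → proj₁ p ℤ.≤ proj₁ v) V → Runs V → Runs (p ∷ V)
extend {p} {V} p∉ p≤ R with right p ∈? V
... | no r∉ = record
  { runs   = (p , 1) ∷ runs
  ; perm   = prep p perm
  ; linked = link
  }
  where
  open Runs R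
  link : ∀ {u} → u ∈ p ∷ V → right u ∈ p ∷ V → Linked ((p , 1) ∷ runs) u
  link (here refl) (here e)   = contradiction (ℤ.≤-reflexive (cong proj₁ e)) (right≰ {p})
  link (here refl) (there r∈) = contradiction r∈ r∉
  -- Here `e` puts `u` one step to the left of `p`, which is leftmost.
  link {u} (there u∈) (here e) = contradiction (subst (λ z → proj₁ z ℤ.≤ proj₁ u) (sym e) (All.lookup p≤ u∈)) (right≰ {u})
  link (there u∈) (there r∈)  = let (q , n , q∈ , i) = linked u∈ r∈ in q , n , there q∈ , i
... | yes r∈ with Runs.runs R | ∈-run (Runs.runs R) (∈-resp-↭ (Runs.perm R) r∈) | Runs.perm R | Runs.linked R
...   | rs | q , n , q∈ , r∈q | perm | linked with right∈segment n r∈q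
-- If `right p` is not the first point of its run, then the run contains `p` as well, contrary to
-- `p ∉ V`.
...     | inj₂ p∈q = contradiction (∈-resp-↭ (↭-sym perm) (segment⊆points q∈ p∈q)) p∉
...     | inj₁ refl with n | extract q∈ | r∈q
...       | suc m | rs′ , rs↭ | _ = record
  { runs   = (p , suc (suc m)) ∷ rs′
  ; perm   = prep p (↭-trans perm (points-↭ rs↭))
  ; linked = link
  }
  where
  link : ∀ {u} → u ∈ p ∷ V → right u ∈ p ∷ V → Linked ((p , suc (suc m)) ∷ rs′) u
  link (here refl) _ = p , suc (suc m) , here refl , here
  link {u} (there u∈) (here e) = contradiction (subst (λ z → proj₁ z ℤ.≤ proj₁ u) (sym e) (All.lookup p≤ u∈)) (right≰ {u})
  link (there u∈) (there r∈)  with q , n , q∈ , i ← linked u∈ r∈ with ∈-resp-↭ rs↭ q∈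
  ... | here refl = p , suc (suc m) , here refl , there i
  ... | there q∈′ = q , n , there q∈′ , i

module ByAbscissa = Data.List.Sort (On.decTotalOrder ℤ.≤-decTotalOrder (proj₁ {A = ℤ} {B = λ _ → ℤ}))

-- After sorting by abscissa, points are added from right to left, so each one is leftmost when
-- `extend` adds it.
decompose : ∀ {V} → Unique V → Runs V
decompose {V} u = Runs-resp-↭ (sort-↭ V)
  (go (Linked⇒AllPairs ℤ.≤-trans (sort-↗ V)) (Unique-resp-↭ (↭-sym (sort-↭ V)) u))
  where
  open ByAbscissa
  go : ∀ {W} → AllPairs (λ v w → proj₁ v ℤ.≤ proj₁ w) W → Unique W → Runs W
  go []       []       = record { runs = [] ; perm = ↭-refl ; linked = λ () }
  go (v≤ ∷ s) u@(_ ∷ u′) = extend (Unique.Unique[x∷xs]⇒x∉xs u) v≤ (go s u′)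

-- Positions in a list

data At {A : Set} : List A → A → ℕ → Set where
  here  : ∀ {x xs} → At (x ∷ xs) x 0
  there : ∀ {x y xs k} → At xs y k → At (x ∷ xs) y (suc k)

At-++⁺ˡ : ∀ {A : Set} {xs ys : List A} {x k} → At xs x k → At (xs ++ ys) x k
At-++⁺ˡ here      = here
At-++⁺ˡ (there a) = there (At-++⁺ˡ a)

At-++⁺ʳ : ∀ {A : Set} (xs : List A) {ys x k} → At ys x k → At (xs ++ ys) x (length xs ℕ.+ k)
At-++⁺ʳ []       a = a
At-++⁺ʳ (_ ∷ xs) a = there (At-++⁺ʳ xs a)

At-∷ʳ : ∀ {A : Set} (xs : List A) {x} → At (xs ∷ʳ x) x (length xs)
At-∷ʳ []       = here
At-∷ʳ (_ ∷ xs) = there (At-∷ʳ xs)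

At-functional : ∀ {A : Set} {xs : List A} {x y k} → At xs x k → At xs y k → x ≡ y
At-functional here      here      = refl
At-functional (there a) (there b) = At-functional a b

At⇒< : ∀ {A : Set} {xs : List A} {x k} → At xs x k → k < length xs
At⇒< here      = z<s
At⇒< (there a) = s<s (At⇒< a)

At⇒∈ : ∀ {A : Set} {xs : List A} {x k} → At xs x k → x ∈ xs
At⇒∈ here      = here refl
At⇒∈ (there a) = there (At⇒∈ a)

position : Point → List Point → ℕ
position v []       = 0
position v (u ∷ us) with v ≟ₚ u
... | yes _ = 0
... | no  _ = suc (position v us)

∈⇒At : ∀ {v us} → v ∈ us → At us v (position v us)
∈⇒At {v} {u ∷ us} v∈ with v ≟ₚ u | v∈
... | yes refl | _        = here
... | no  v≢u  | here e   = contradiction e v≢u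
... | no  _    | there v∈ = there (∈⇒At v∈)

At⇒position : ∀ {v us k} → Unique us → At us v k → position v us ≡ k
At⇒position {v} {u ∷ us} (u≢ ∷ _) here with v ≟ₚ u
... | yes _   = refl
... | no  v≢v = contradiction refl v≢v
At⇒position {v} {u ∷ us} (u≢ ∷ un) (there a) with v ≟ₚ u
... | yes refl = contradiction refl (All.lookup u≢ (At⇒∈ a))
... | no  _    = cong suc (At⇒position un a)

-- Checkerboard colouring

parityℤ : ℤ → Parity
parityℤ i = parity ∣ i ∣

parity-suc : ∀ n → parity (suc n) ≡ parity n ⁻¹
parity-suc n = ℙ.+-homo-+ 1 n

parityℤ-suc : ∀ i → parityℤ (ℤ.suc i) ≡ parityℤ i ⁻¹
parityℤ-suc (+ n)          = parity-suc n
parityℤ-suc -[1+ zero ]    = refl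
parityℤ-suc -[1+ (suc n) ] = trans (sym (ℙ.⁻¹-involutive _)) (cong _⁻¹ (sym (parity-suc (suc n))))

colour : Point → Parity
colour (x , y) = parityℤ x ℙ.+ parityℤ y

⁻¹-+ˡ : ∀ p q → p ⁻¹ ℙ.+ q ≡ (p ℙ.+ q) ⁻¹
⁻¹-+ˡ 0ℙ q = refl
⁻¹-+ˡ 1ℙ q = sym (ℙ.⁻¹-involutive q)

colour-right : ∀ p → colour (right p) ≡ colour p ⁻¹
colour-right (x , y) = trans (cong (ℙ._+ parityℤ y) (parityℤ-suc x)) (⁻¹-+ˡ (parityℤ x) (parityℤ y))

colour-swap : ∀ p → colour (swap p) ≡ colour p
colour-swap (x , y) = ℙ.+-comm (parityℤ y) (parityℤ x)

colour-up : ∀ p → colour (up p) ≡ colour p ⁻¹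
colour-up p = trans (sym (colour-swap (up p))) (trans (colour-right (swap p)) (cong _⁻¹ (colour-swap p)))

-- Arrangements of runs

-- Positions are counted from one of parity `q`. The points `u` and `right u` are neighbours in the
-- list, in either order, and the parity of the earlier position is `colour u`. Labels whose
-- consecutive sums depend on this parity thus have edge sums that depend on the colour.
record Consecutive (q : Parity) (us : List Point) (u : Point) : Set where
  constructor consecutive
  field
    k         : ℕ
    parity-k  : q ℙ.+ parity k ≡ colour u
    neighbour : At us u k × At us (right u) (suc k) ⊎ At us (right u) k × At us u (suc k)

Consecutive-++⁺ˡ : ∀ {q us vs u} → Consecutive q us u → Consecutive q (us ++ vs) u
Consecutive-++⁺ˡ (consecutive k e a) = consecutive k e (Sum.map both both a)
  where
  both : ∀ {us vs : List Point} {x y i j} → At us x i × At us y j → At (us ++ vs) x i × At (us ++ vs) y j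
  both (a , b) = At-++⁺ˡ a , At-++⁺ˡ b

Consecutive-++⁺ʳ : ∀ {q} us {vs u} → Consecutive (q ℙ.+ parity (length us)) vs u → Consecutive q (us ++ vs) u
Consecutive-++⁺ʳ {q} us {vs} (consecutive k e a) = consecutive
  (length us ℕ.+ k)
  (trans (cong (q ℙ.+_) (ℙ.+-homo-+ (length us) k)) (trans (sym (ℙ.+-assoc q _ _)) e))
  (Sum.map both both a)
  where
  both : ∀ {x y k} → At vs x k × At vs y (suc k) →
         At (us ++ vs) x (length us ℕ.+ k) × At (us ++ vs) y (suc (length us ℕ.+ k))
  both {y = y} {k} (a , b) = At-++⁺ʳ us a , subst (At (us ++ vs) y) (ℕ.+-suc (length us) k) (At-++⁺ʳ us b)

segmentʳ : Point → ℕ → List Point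
segmentʳ p zero    = []
segmentʳ p (suc n) = segmentʳ (right p) n ∷ʳ p

length-segment : ∀ p n → length (segment p n) ≡ n
length-segment p zero    = refl
length-segment p (suc n) = cong suc (length-segment (right p) n)

segmentʳ-↭ : ∀ p n → segmentʳ p n ↭ segment p n
segmentʳ-↭ p zero    = ↭-refl
segmentʳ-↭ p (suc n) = ↭-trans (↭-sym (∷↭∷ʳ p _)) (prep p (segmentʳ-↭ (right p) n))

length-segmentʳ : ∀ p n → length (segmentʳ p n) ≡ n
length-segmentʳ p n = trans (↭-length (segmentʳ-↭ p n)) (length-segment p n)

-- Position and colour alternate together along the run, so agreement at its first point suffices.
segment-consecutive : ∀ {q p n u} → colour p ≡ q → Inner p n u → Consecutive q (segment p n) u
segment-consecutive {q} c here = consecutive 0 (trans (ℙ.+-identityʳ q) (sym c)) (inj₁ (here , there here))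
segment-consecutive {q} {p} c (there i) = Consecutive-++⁺ʳ (p ∷ [])
  (segment-consecutive (trans (colour-right p) (trans (cong _⁻¹ c) (ℙ.+-comm 1ℙ q))) i)

-- In the reversed run the edge at `p` occupies the positions `n - 2` and `n - 1`, so its earlier
-- position has the parity of `n`.
segmentʳ-consecutive : ∀ {q p n u} → colour p ≡ q ℙ.+ parity n → Inner p n u → Consecutive q (segmentʳ p n) u
segmentʳ-consecutive {q} {p} {suc (suc n)} c here = consecutive n (sym c) (inj₂ (At-++⁺ˡ r , l))
  where
  us = segmentʳ (right (right p)) n
  len : length us ≡ n
  len = length-segmentʳ _ n
  r : At (us ∷ʳ right p) (right p) n
  r = subst (At _ _) len (At-∷ʳ us)
  l : At (us ∷ʳ right p ∷ʳ p) p (suc n)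
  l = subst (At _ _) (length-segmentʳ (right p) (suc n)) (At-∷ʳ (us ∷ʳ right p))
segmentʳ-consecutive {q} {p} {suc n} c (there i) = Consecutive-++⁺ˡ (segmentʳ-consecutive
  (trans (colour-right p) (trans (cong _⁻¹ (trans c (cong (q ℙ.+_) (parity-suc n)))) (lemma q (parity n)))) i)
  where
  lemma : ∀ q r → (q ℙ.+ r ⁻¹) ⁻¹ ≡ q ℙ.+ r
  lemma 0ℙ r = ℙ.⁻¹-involutive r
  lemma 1ℙ r = cong _⁻¹ (ℙ.⁻¹-involutive r)

-- Here `q` is the parity of the position at which the run begins.
data Fits (q : Parity) : Run → Set where
  odd  : ∀ {p n} → parity n ≡ 1ℙ → Fits q (p , n)
  even : ∀ {p n} → parity n ≡ 0ℙ → colour p ≡ q → Fits q (p , n)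

data Arrangeable : Parity → List Run → Set where
  []  : ∀ {q} → Arrangeable q []
  _∷_ : ∀ {q p n rs} → Fits q (p , n) → Arrangeable (q ℙ.+ parity n) rs → Arrangeable q ((p , n) ∷ rs)

record Arrangement (q : Parity) (us : List Point) (linked : Point → Set) : Set where
  constructor arrangement
  field
    order       : List Point
    order-↭     : order ↭ us
    consec      : ∀ {u} → linked u → Consecutive q order u

-- Listed forwards, the run requires `colour p` to be `q`; backwards, `q` plus the parity of `n`.
-- These conditions coincide for even `n` and are complementary for odd `n`.
arrange₁ : ∀ {q p n} → Fits q (p , n) → Arrangement q (segment p n) (Inner p n)
arrange₁ {q} {p} {n} (even _ c) = arrangement (segment p n) ↭-refl (segment-consecutive c)
arrange₁ {q} {p} {n} (odd o) with colour p ℙ.≟ q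
... | yes c = arrangement (segment p n) ↭-refl (segment-consecutive c)
... | no ¬c = arrangement (segmentʳ p n) (segmentʳ-↭ p n)
                (segmentʳ-consecutive (trans (other _ _ ¬c) (trans (ℙ.+-comm 1ℙ q) (cong (q ℙ.+_) (sym o)))))
  where
  other : ∀ a b → a ≢ b → a ≡ b ⁻¹
  other 0ℙ 0ℙ ne = contradiction refl ne
  other 0ℙ 1ℙ _  = refl
  other 1ℙ 0ℙ _  = refl
  other 1ℙ 1ℙ ne = contradiction refl ne

arrange : ∀ {q rs} → Arrangeable q rs → Arrangement q (points rs) (Linked rs)
arrange [] = arrangement [] ↭-refl λ ()
arrange {q} (_∷_ {p = p} {n} {rs} f fs) = arrangement (order₁ ++ order) (++⁺ order₁-↭ order-↭) cons
  where
  open Arrangement (arrange₁ f) renaming (order to order₁; order-↭ to order₁-↭; consec to consec₁)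
  open Arrangement (arrange fs)
  len : length order₁ ≡ n
  len = trans (↭-length order₁-↭) (length-segment p n)
  cons : ∀ {u} → Linked ((p , n) ∷ rs) u → Consecutive q (order₁ ++ order) u
  cons (_ , _ , here refl , i) = Consecutive-++⁺ˡ (consec₁ i)
  cons {u} (p′ , n′ , there r∈ , i) = Consecutive-++⁺ʳ order₁
    (subst (λ k → Consecutive (q ℙ.+ parity k) order u) (sym len) (consec (p′ , n′ , r∈ , i)))

OddRun : Run → Set
OddRun (p , n) = parity n ≡ 1ℙ

EvenRun : Parity → Run → Set
EvenRun q (p , n) = parity n ≡ 0ℙ × colour p ≡ q

record Classified (rs : List Run) : Set where
  constructor classified
  field
    {as bs os} : List Run
    perm       : rs ↭ as ++ bs ++ os
    as-even    : All (EvenRun 0ℙ) as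
    bs-even    : All (EvenRun 1ℙ) bs
    os-odd     : All OddRun os

classify : ∀ rs → Classified rs
classify [] = classified ↭-refl [] [] []
classify (r@(p , n) ∷ rs) with classify rs | parity n in e | colour p in c
... | classified {as} {bs} {os} perm a b o | 1ℙ | _ =
  classified (↭-trans (prep r perm) (↭-trans (↭-sym (shift r as _)) (++⁺ˡ as (↭-sym (shift r bs os))))) a b (e ∷ o)
... | classified {as} {bs} {os} perm a b o | 0ℙ | 0ℙ =
  classified (prep r perm) ((e , c) ∷ a) b o
... | classified {as} {bs} {os} perm a b o | 0ℙ | 1ℙ =
  classified (↭-trans (prep r perm) (↭-sym (shift r as _))) a ((e , c) ∷ b) o

-- An even run leaves the parity of the next free position unchanged.
evens-arrangeable : ∀ {q rs ss} → All (EvenRun q) rs → Arrangeable q ss → Arrangeable q (rs ++ ss)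
evens-arrangeable [] ss = ss
evens-arrangeable {q} {(p , n) ∷ rs} {ss} ((e , c) ∷ es) fs =
  even e c ∷ subst (λ r → Arrangeable r (rs ++ ss)) (sym (trans (cong (q ℙ.+_) e) (ℙ.+-identityʳ q))) (evens-arrangeable es fs)

odds-arrangeable : ∀ {q rs} → All OddRun rs → Arrangeable q rs
odds-arrangeable []       = []
odds-arrangeable (o ∷ os) = odd o ∷ odds-arrangeable os

-- The odd run in the middle switches the parity of the positions.
odd-arrangeable : ∀ {as o bs os} → All (EvenRun 0ℙ) as → OddRun o → All (EvenRun 1ℙ) bs → All OddRun os →
                  Arrangeable 0ℙ (as ++ o ∷ bs ++ os)
odd-arrangeable {as} {o} {bs} {os} a e b o′ =
  evens-arrangeable a (odd e ∷ subst (λ r → Arrangeable r (bs ++ os)) (sym e) (evens-arrangeable b (odds-arrangeable o′)))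

Unique-++⁻ : ∀ {A : Set} (xs : List A) {ys} → Unique (xs ++ ys) →
             Unique xs × Unique ys × (∀ {x} → x ∈ xs → x ∉ ys)
Unique-++⁻ []       u         = [] , u , λ ()
Unique-++⁻ (x ∷ xs) (x≢ ∷ u) with uxs , uys , dis ← Unique-++⁻ xs u =
  All.++⁻ˡ xs x≢ ∷ uxs , uys , λ where
    (here refl) x∈ys → All.lookup (All.++⁻ʳ xs x≢) x∈ys refl
    (there x∈)       → dis x∈

-- Magic labellings

-- The sum is constant over all unit squares with four corners in `V`, whether or not they are
-- cells. Only injectivity into the set of labels is recorded; surjectivity follows by counting.
record Magic (V : List Point) : Set where
  field
    label           : Point → ℕ
    label-positive  : ∀ {v} → v ∈ V → 1 ≤ label v
    label-bounded   : ∀ {v} → v ∈ V → label v ≤ length V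
    label-injective : ∀ {v w} → v ∈ V → w ∈ V → label v ≡ label w → v ≡ w
    constant        : ℕ
    square-sum      : ∀ u → u ∈ V → right u ∈ V → up u ∈ V → right (up u) ∈ V →
                      label u ℕ.+ label (right u) ℕ.+ (label (up u) ℕ.+ label (right (up u))) ≡ constant

Magic-resp-↭ : ∀ {V W} → V ↭ W → Magic V → Magic W
Magic-resp-↭ {V} {W} p M = record
  { label           = label
  ; label-positive  = label-positive ∘ back
  ; label-bounded   = λ v∈ → subst (_ ≤_) (↭-length p) (label-bounded (back v∈))
  ; label-injective = λ v∈ w∈ → label-injective (back v∈) (back w∈)
  ; constant        = constant
  ; square-sum      = λ u a b c d → square-sum u (back a) (back b) (back c) (back d)
  }
  where
  open Magic M
  back : ∀ {v} → v ∈ W → v ∈ V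
  back = ∈-resp-↭ (↭-sym p)

-- Reflection in the diagonal turns vertical runs into horizontal ones and maps unit squares to unit
-- squares.
Magic-swap : ∀ {V} → Magic (map swap V) → Magic V
Magic-swap {V} M = record
  { label           = label ∘ swap
  ; label-positive  = label-positive ∘ ∈-map⁺ swap
  ; label-bounded   = λ v∈ → subst (_ ≤_) (length-map swap V) (label-bounded (∈-map⁺ swap v∈))
  ; label-injective = λ v∈ w∈ e → cong swap (label-injective (∈-map⁺ swap v∈) (∈-map⁺ swap w∈) e)
  ; constant        = constant
  ; square-sum      = λ u a b c d → trans (interchange (label (swap u)) _ _ _)
      (square-sum (swap u) (∈-map⁺ swap a) (∈-map⁺ swap c) (∈-map⁺ swap b) (∈-map⁺ swap d))
  }
  where
  open Magic M
  interchange : ∀ a b c d → a ℕ.+ b ℕ.+ (c ℕ.+ d) ≡ a ℕ.+ c ℕ.+ (b ℕ.+ d)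
  interchange = solve 4 (λ a b c d → a :+ b :+ (c :+ d) := a :+ c :+ (b :+ d)) refl
    where open ℕ.+-*-Solver

-- Slot (k , 0ℙ) holds the k-th smallest label and slot (k , 1ℙ) the k-th largest one.
Slot : Set
Slot = ℕ × Parity

-- The bounds admit the lower half of the labels, rounded up, as small ones and the upper half,
-- rounded down, as large ones.
Valid : ℕ → Slot → Set
Valid N (k , 0ℙ) = k ℕ.+ k < N
Valid N (k , 1ℙ) = suc (k ℕ.+ k) < N

slotLabel : ℕ → Slot → ℕ
slotLabel N (k , 0ℙ) = suc k
slotLabel N (k , 1ℙ) = N ∸ k

Valid⇒< : ∀ {N} s → Valid N s → proj₁ s < N
Valid⇒< (k , 0ℙ) v = ℕ.≤-<-trans (ℕ.m≤m+n k k) v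
Valid⇒< (k , 1ℙ) v = ℕ.≤-<-trans (ℕ.m≤m+n k k) (ℕ.<-trans (ℕ.n<1+n _) v)

slotLabel-positive : ∀ {N} s → Valid N s → 1 ≤ slotLabel N s
slotLabel-positive (k , 0ℙ)   v = s≤s z≤n
slotLabel-positive s@(k , 1ℙ) v = ℕ.m<n⇒0<n∸m (Valid⇒< s v)

slotLabel-bounded : ∀ {N} s → Valid N s → slotLabel N s ≤ N
slotLabel-bounded s@(k , 0ℙ)   v = Valid⇒< s v
slotLabel-bounded {N} (k , 1ℙ) v = ℕ.m∸n≤m N k

-- Equality would give `k + l + 1 = N`, hence `2k + (2l + 2) = 2N`, although `2k < N` and
-- `2l + 2 ≤ N`.
small≢large : ∀ {N k l} → Valid N (k , 0ℙ) → Valid N (l , 1ℙ) → suc k ≢ N ∸ l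
small≢large {N} {k} {l} v w e = ℕ.<-irrefl twice (ℕ.+-mono-<-≤ v w)
  where
  open ℕ.+-*-Solver
  total : suc k ℕ.+ l ≡ N
  total = trans (cong (ℕ._+ l) e) (ℕ.m∸n+n≡m (ℕ.<⇒≤ (Valid⇒< (l , 1ℙ) w)))
  twice : k ℕ.+ k ℕ.+ suc (suc (l ℕ.+ l)) ≡ N ℕ.+ N
  twice = trans (solve 2 (λ k l → k :+ k :+ (con 2 :+ (l :+ l)) := con 1 :+ k :+ l :+ (con 1 :+ k :+ l)) refl k l)
              (cong₂ ℕ._+_ total total)

slotLabel-injective : ∀ {N} s t → Valid N s → Valid N t → slotLabel N s ≡ slotLabel N t → s ≡ t
slotLabel-injective (k , 0ℙ) (l , 0ℙ) v w e = cong (_, 0ℙ) (ℕ.suc-injective e)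
slotLabel-injective (k , 0ℙ) (l , 1ℙ) v w e = contradiction e (small≢large {k = k} {l} v w)
slotLabel-injective (k , 1ℙ) (l , 0ℙ) v w e = contradiction (sym e) (small≢large {k = l} {k} w v)
slotLabel-injective s@(k , 1ℙ) t@(l , 1ℙ) v w e =
  cong (_, 1ℙ) (ℕ.∸-cancelˡ-≡ (ℕ.<⇒≤ (Valid⇒< s v)) (ℕ.<⇒≤ (Valid⇒< t w)) e)

-- It is enough to make the horizontal edge sums depend on the colour of the left endpoint only:
-- the two horizontal sides of a square have left endpoints of different colours.
slots⇒magic : ∀ {V} (slot : Point → Slot) →
  (∀ {v} → v ∈ V → Valid (length V) (slot v)) →
  (∀ {v w} → v ∈ V → w ∈ V → slot v ≡ slot w → v ≡ w) →
  (edgeSum : Parity → ℕ) →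
  (∀ {u} → u ∈ V → right u ∈ V →
    slotLabel (length V) (slot u) ℕ.+ slotLabel (length V) (slot (right u)) ≡ edgeSum (colour u)) →
  Magic V
slots⇒magic {V} slot valid injective edgeSum edge = record
  { label           = λ v → slotLabel N (slot v)
  ; label-positive  = λ v∈ → slotLabel-positive _ (valid v∈)
  ; label-bounded   = λ v∈ → slotLabel-bounded _ (valid v∈)
  ; label-injective = λ v∈ w∈ e → injective v∈ w∈ (slotLabel-injective _ _ (valid v∈) (valid w∈) e)
  ; constant        = edgeSum 0ℙ ℕ.+ edgeSum 1ℙ
  ; square-sum      = λ u a b c d → trans
      (cong₂ ℕ._+_ (edge a b) (trans (edge c d) (cong edgeSum (colour-up u)))) (both (colour u))
  }
  where
  N = length V
  both : ∀ q → edgeSum q ℕ.+ edgeSum (q ⁻¹) ≡ edgeSum 0ℙ ℕ.+ edgeSum 1ℙ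
  both 0ℙ = refl
  both 1ℙ = ℕ.+-comm (edgeSum 1ℙ) (edgeSum 0ℙ)

-- Labels along a single path

double-half : ∀ {q} n → parity n ≡ q → (q ≡ 0ℙ → ⌊ n /2⌋ ℕ.+ ⌊ n /2⌋ ≡ n) × (q ≡ 1ℙ → suc (⌊ n /2⌋ ℕ.+ ⌊ n /2⌋) ≡ n)
double-half 0 refl = (λ _ → refl) , λ ()
double-half 1 refl = (λ ()) , λ _ → refl
double-half (suc (suc n)) e with ev , od ← double-half n e =
  (λ z → cong suc (trans (ℕ.+-suc _ _) (cong suc (ev z)))) ,
  (λ z → cong (suc ∘ suc) (trans (ℕ.+-suc _ _) (od z)))

-- At the positions 0, 1, 2, 3, ... the labels are 1, `N`, 2, `N - 1`, ....
halfSlot : ℕ → Slot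
halfSlot p = ⌊ p /2⌋ , parity p

halfSlot-valid : ∀ {N} p → p < N → Valid N (halfSlot p)
halfSlot-valid {N} p p<N with parity p in e
... | 0ℙ = subst (_< N) (sym (proj₁ (double-half p e) refl)) p<N
... | 1ℙ = subst (_< N) (sym (proj₂ (double-half p e) refl)) p<N

halfSlot-injective : ∀ p r → halfSlot p ≡ halfSlot r → p ≡ r
halfSlot-injective 0             0             e = refl
halfSlot-injective 0             1             ()
halfSlot-injective 0             (suc (suc r)) ()
halfSlot-injective 1             0             ()
halfSlot-injective 1             1             e = refl
halfSlot-injective 1             (suc (suc r)) ()
halfSlot-injective (suc (suc p)) 0             ()
halfSlot-injective (suc (suc p)) 1             ()
halfSlot-injective (suc (suc p)) (suc (suc r)) e =
  cong (suc ∘ suc) (halfSlot-injective p r (cong₂ _,_ (ℕ.suc-injective (cong proj₁ e)) (cong proj₂ e)))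

suc-half : ∀ {q} n → parity n ≡ q → (q ≡ 0ℙ → ⌊ suc n /2⌋ ≡ ⌊ n /2⌋) × (q ≡ 1ℙ → ⌊ suc n /2⌋ ≡ suc ⌊ n /2⌋)
suc-half 0 refl = (λ _ → refl) , λ ()
suc-half 1 refl = (λ ()) , λ _ → refl
suc-half (suc (suc n)) e with ev , od ← suc-half n e = (λ z → cong suc (ev z)) , (λ z → cong suc (od z))

parity-suc′ : ∀ n {q} → parity n ≡ q → parity (suc n) ≡ q ⁻¹
parity-suc′ n e = trans (parity-suc n) (cong _⁻¹ e)

pathSum : ℕ → Parity → ℕ
pathSum N 0ℙ = suc N
pathSum N 1ℙ = suc (suc N)

-- With `h = ⌊ k /2⌋`, the two labels are `h + 1` and `N - h` for even `k`, and `N - h` and `h + 2`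
-- for odd `k`.
halfSlot-sum : ∀ {N} k → k < N → slotLabel N (halfSlot k) ℕ.+ slotLabel N (halfSlot (suc k)) ≡ pathSum N (parity k)
halfSlot-sum {N} k k<N with parity k in e
... | 0ℙ rewrite parity-suc′ k e | proj₁ (suc-half k e) refl = cong suc (ℕ.m+[n∸m]≡n h≤)
  where
  h≤ : ⌊ k /2⌋ ≤ N
  h≤ = ℕ.≤-trans (ℕ.⌊n/2⌋≤n k) (ℕ.<⇒≤ k<N)
... | 1ℙ rewrite parity-suc′ k e | proj₂ (suc-half k e) refl =
  trans (ℕ.+-suc _ _) (cong suc (trans (ℕ.+-suc _ _) (cong suc (ℕ.m∸n+n≡m h≤))))
  where
  h≤ : ⌊ k /2⌋ ≤ N
  h≤ = ℕ.≤-trans (ℕ.⌊n/2⌋≤n k) (ℕ.<⇒≤ k<N)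

∈⇒position< : ∀ {v us} → v ∈ us → position v us < length us
∈⇒position< = At⇒< ∘ ∈⇒At

position-injective : ∀ {v w us} → v ∈ us → w ∈ us → position v us ≡ position w us → v ≡ w
position-injective {v} {w} {us} v∈ w∈ e = At-functional (subst (At us v) e (∈⇒At v∈)) (∈⇒At w∈)

arrangeable⇒magic : ∀ {V} → Unique V → (R : Runs V) → Arrangeable 0ℙ (Runs.runs R) → Magic V
arrangeable⇒magic {V} V! R fits =
  Magic-resp-↭ order↭V (slots⇒magic (λ v → halfSlot (position v order))
    (λ v∈ → halfSlot-valid _ (∈⇒position< v∈))
    (λ v∈ w∈ e → position-injective v∈ w∈ (halfSlot-injective _ _ e))
    (pathSum N) edge)
  where
  open Runs R
  open Arrangement (arrange fits)
  N = length order
  order↭V : order ↭ V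
  order↭V = ↭-trans order-↭ (↭-sym perm)
  order! : Unique order
  order! = Unique-resp-↭ (↭-sym order↭V) V!
  slotAt : Point → ℕ
  slotAt v = slotLabel N (halfSlot (position v order))
  step : ∀ {v w k} → At order v k → At order w (suc k) → slotAt v ℕ.+ slotAt w ≡ pathSum N (parity k)
  step {v} {w} {k} a b rewrite At⇒position order! a | At⇒position order! b = halfSlot-sum k (At⇒< a)
  edge : ∀ {u} → u ∈ order → right u ∈ order → slotAt u ℕ.+ slotAt (right u) ≡ pathSum N (colour u)
  edge {u} u∈ r∈ with consec (linked (∈-resp-↭ order↭V u∈) (∈-resp-↭ order↭V r∈))
  ... | consecutive k e (inj₁ (a , b)) = trans (step a b) (cong (pathSum N) e)
  ... | consecutive k e (inj₂ (a , b)) = trans (ℕ.+-comm (slotAt u) _) (trans (step a b) (cong (pathSum N) e))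

-- Labels along two paths of equal length

twinSum : ℕ → Parity → ℕ
twinSum N 0ℙ = N
twinSum N 1ℙ = suc (suc N)

-- At each step the index grows and the kind flips: `k + 1` is followed by `N - (k + 1)`, and
-- `N - k` by `k + 2`.
twinSlot-sum : ∀ {N} k s → suc k ≤ N → slotLabel N (k , s) ℕ.+ slotLabel N (suc k , s ⁻¹) ≡ twinSum N s
twinSlot-sum k 0ℙ k<N = ℕ.m+[n∸m]≡n k<N
twinSlot-sum k 1ℙ k<N = trans (ℕ.+-suc _ _) (cong suc (trans (ℕ.+-suc _ _) (cong suc (ℕ.m∸n+n≡m (ℕ.<⇒≤ k<N)))))

twinSlot-valid : ∀ {M} k s → k < M → Valid (M ℕ.+ M) (k , s)
twinSlot-valid k 0ℙ k<M = ℕ.+-mono-< k<M k<M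
twinSlot-valid {M} k 1ℙ k<M = ℕ.≤-trans (ℕ.≤-reflexive (cong suc (sym (ℕ.+-suc k k)))) (ℕ.+-mono-≤ k<M k<M)

points-++ : ∀ rs ss → points (rs ++ ss) ≡ points rs ++ points ss
points-++ rs ss = concatMap-++ (uncurry segment) rs ss

-- Two paths of `N / 2` points each use the same indices, with opposite kinds at equal positions.
-- Together they exhaust the slots, and the initial parity of each path matches the colour of its
-- even runs.
balanced⇒magic : ∀ {V as bs} → Unique V → (R : Runs V) → Runs.runs R ↭ as ++ bs →
  Arrangeable 0ℙ as → Arrangeable 1ℙ bs → length (points as) ≡ length (points bs) → Magic V
balanced⇒magic {V} {as} {bs} V! R split fitsᵃ fitsᵇ balance =
  Magic-resp-↭ U↭V (slots⇒magic slot valid injective (twinSum N) edge)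
  where
  open Runs (reorder R split)
  open Arrangement (arrange fitsᵃ) renaming (order to A; order-↭ to A↭; consec to consecᵃ)
  open Arrangement (arrange fitsᵇ) renaming (order to B; order-↭ to B↭; consec to consecᵇ)
  U = A ++ B
  M = length A
  N = length U
  U↭V : U ↭ V
  U↭V = ↭-trans (++⁺ A↭ B↭) (↭-trans (↭-reflexive (sym (points-++ as bs))) (↭-sym perm))
  unique = Unique-++⁻ A (Unique-resp-↭ (↭-sym U↭V) V!)
  A! = proj₁ unique
  B! = proj₁ (proj₂ unique)
  disjoint = proj₂ (proj₂ unique)
  M≡ : M ≡ length B
  M≡ = trans (↭-length A↭) (trans balance (sym (↭-length B↭)))
  N≡ : N ≡ M ℕ.+ M
  N≡ = trans (length-++ A) (cong (M ℕ.+_) (sym M≡))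
  -- The path with `q = 0ℙ` starts with the smallest label, the one with `q = 1ℙ` with the largest.
  slotIn : Parity → List Point → Point → Slot
  slotIn q us v = position v us , q ℙ.+ parity (position v us)
  slot : Point → Slot
  slot v with v ∈? A
  ... | yes _ = slotIn 0ℙ A v
  ... | no  _ = slotIn 1ℙ B v
  other : ∀ {v} → v ∈ U → v ∉ A → v ∈ B
  other v∈ v∉ with ∈-++⁻ A v∈
  ... | inj₁ v∈A = contradiction v∈A v∉
  ... | inj₂ v∈B = v∈B
  slotᵃ : ∀ {v} → v ∈ A → slot v ≡ slotIn 0ℙ A v
  slotᵃ {v} v∈ with v ∈? A
  ... | yes _ = refl
  ... | no v∉ = contradiction v∈ v∉
  slotᵇ : ∀ {v} → v ∈ B → slot v ≡ slotIn 1ℙ B v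
  slotᵇ {v} v∈ with v ∈? A
  ... | yes v∈A = contradiction v∈ (disjoint v∈A)
  ... | no _ = refl
  valid : ∀ {v} → v ∈ U → Valid N (slot v)
  valid {v} v∈ with v ∈? A
  ... | yes v∈A = subst (λ n → Valid n (slotIn 0ℙ A v)) (sym N≡) (twinSlot-valid _ _ (∈⇒position< v∈A))
  ... | no  v∉A = subst (λ n → Valid n (slotIn 1ℙ B v)) (sym N≡)
                    (twinSlot-valid _ _ (subst (_ <_) (sym M≡) (∈⇒position< (other v∈ v∉A))))
  -- Slots of the two paths with the same index come from the same position, where the kinds differ.
  clash : ∀ {k l} → (k , parity k) ≢ (l , parity l ⁻¹)
  clash {k} e with refl ← cong proj₁ e = ℙ.p≢p⁻¹ (parity k) (cong proj₂ e)
  injective : ∀ {v w} → v ∈ U → w ∈ U → slot v ≡ slot w → v ≡ w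
  injective {v} {w} v∈ w∈ e with v ∈? A | w ∈? A
  ... | yes v∈A | yes w∈A = position-injective v∈A w∈A (cong proj₁ e)
  ... | yes _   | no  _   = contradiction e clash
  ... | no  _   | yes _   = contradiction (sym e) clash
  ... | no v∉A  | no w∉A  = position-injective (other v∈ v∉A) (other w∈ w∉A) (cong proj₁ e)
  bound : ∀ {k} → k < M → suc k ≤ N
  bound k<M = ℕ.≤-trans k<M (subst (M ≤_) (sym N≡) (ℕ.m≤m+n M M))
  step : ∀ {q us v w k} → Unique us → k < M → At us v k → At us w (suc k) →
         slotLabel N (slotIn q us v) ℕ.+ slotLabel N (slotIn q us w) ≡ twinSum N (q ℙ.+ parity k)
  step {q} {k = k} us! k<M a b
    rewrite At⇒position us! a | At⇒position us! b =
      trans (cong (λ s → slotLabel N (k , q ℙ.+ parity k) ℕ.+ slotLabel N (suc k , s)) flip)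
            (twinSlot-sum k (q ℙ.+ parity k) (bound k<M))
    where
    flip : q ℙ.+ parity (suc k) ≡ (q ℙ.+ parity k) ⁻¹
    flip = trans (cong (q ℙ.+_) (parity-suc k)) (lemma q)
      where
      lemma : ∀ q → q ℙ.+ parity k ⁻¹ ≡ (q ℙ.+ parity k) ⁻¹
      lemma 0ℙ = refl
      lemma 1ℙ = refl
  inside : ∀ {q us u} → Unique us → (∀ {k v} → At us v k → k < M) → (∀ {v} → v ∈ us → slot v ≡ slotIn q us v) →
           Consecutive q us u → slotLabel N (slot u) ℕ.+ slotLabel N (slot (right u)) ≡ twinSum N (colour u)
  inside {q} us! <M slot≡ (consecutive k e (inj₁ (a , b)))
    rewrite slot≡ (At⇒∈ a) | slot≡ (At⇒∈ b) = trans (step {q} us! (<M a) a b) (cong (twinSum N) e)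
  inside {q} {us} {u} us! <M slot≡ (consecutive k e (inj₂ (a , b)))
    rewrite slot≡ (At⇒∈ a) | slot≡ (At⇒∈ b) =
      trans (ℕ.+-comm (slotLabel N (slotIn q us u)) _) (trans (step {q} us! (<M a) a b) (cong (twinSum N) e))
  edge : ∀ {u} → u ∈ U → right u ∈ U → slotLabel N (slot u) ℕ.+ slotLabel N (slot (right u)) ≡ twinSum N (colour u)
  -- An edge lies inside one run, so both of its ends belong to the same path.
  edge u∈ r∈ with linked (∈-resp-↭ U↭V u∈) (∈-resp-↭ U↭V r∈)
  ... | p , n , r∈rs , i with ∈-++⁻ as r∈rs
  ...   | inj₁ r∈as = inside A! At⇒< slotᵃ (consecᵃ (p , n , r∈as , i))
  ...   | inj₂ r∈bs = inside B! (λ a → subst (_ <_) (sym M≡) (At⇒< a)) slotᵇ (consecᵇ (p , n , r∈bs , i))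

-- Balance of the two kinds of even runs

signed : Parity → ℤ → ℤ
signed 0ℙ i = i
signed 1ℙ i = ℤ.- i

-- The summand `(-1)^(x+y) x`, to be summed both along rows and along columns.
weight : Point → ℤ
weight p = signed (colour p) (proj₁ p)

total : (Point → ℤ) → List Point → ℤ
total w us = foldr ℤ._+_ ℤ.0ℤ (map w us)

total-↭ : ∀ w {us vs} → us ↭ vs → total w us ≡ total w vs
total-↭ w p = ↭ₛ.foldr-commMonoid (setoid ℤ) ℤ.+-0-isCommutativeMonoid (↭⇒↭ₛ (map⁺ w p))

total-++ : ∀ w us {vs} → total w (us ++ vs) ≡ total w us ℤ.+ total w vs
total-++ w []       = sym (ℤ.+-identityˡ _)
total-++ w (u ∷ us) = trans (cong (ℤ._+_ (w u)) (total-++ w us)) (sym (ℤ.+-assoc (w u) _ _))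

total-swap : ∀ us → total weight us ≡ total (weight ∘ swap) (map swap us)
total-swap []       = refl
total-swap (u ∷ us) = cong (ℤ._+_ (weight u)) (total-swap us)

colour-right² : ∀ p → colour (right (right p)) ≡ colour p
colour-right² p = trans (colour-right (right p)) (trans (cong _⁻¹ (colour-right p)) (ℙ.⁻¹-involutive (colour p)))

signed-pair : ∀ q i → signed q i ℤ.+ signed (q ⁻¹) i ≡ ℤ.0ℤ
signed-pair 0ℙ i = ℤ.+-inverseʳ i
signed-pair 1ℙ i = ℤ.+-inverseˡ i

signed-step : ∀ q i → signed q i ℤ.+ signed (q ⁻¹) (ℤ.suc i) ≡ signed q ℤ.-1ℤ
signed-step 0ℙ = solve 1 (λ i → i :+ :- (con (+ 1) :+ i) := con ℤ.-1ℤ) refl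
  where open ℤ.+-*-Solver
signed-step 1ℙ = solve 1 (λ i → :- i :+ (con (+ 1) :+ i) := con (+ 1)) refl
  where open ℤ.+-*-Solver

signed-even : ∀ q n → signed q ℤ.-1ℤ ℤ.+ signed q ℤ.-1ℤ ℤ.+ signed q (ℤ.- + n) ≡ signed q (ℤ.- + (suc (suc n)))
signed-even 0ℙ n = sym (ℤ.neg-distrib-+ (+ 2) (+ n))
signed-even 1ℙ n = trans (cong (ℤ._+_ (+ 2)) (ℤ.neg-involutive (+ n))) (sym (ℤ.neg-involutive (+ (2 ℕ.+ n))))

-- Neighbouring points form `n / 2` pairs, each contributing `x - (x + 1) = -1` up to the common
-- sign. Doubling the total avoids the division.
segment-weight : ∀ p n → parity n ≡ 0ℙ →
  total weight (segment p n) ℤ.+ total weight (segment p n) ≡ signed (colour p) (ℤ.- + n)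
segment-weight p 0 e = sym (zeroes (colour p))
  where
  zeroes : ∀ q → signed q ℤ.0ℤ ≡ ℤ.0ℤ
  zeroes 0ℙ = refl
  zeroes 1ℙ = refl
segment-weight p (suc (suc n)) e = begin
  a ℤ.+ (b ℤ.+ t) ℤ.+ (a ℤ.+ (b ℤ.+ t))
    ≡⟨ solve 3 (λ a b t → a :+ (b :+ t) :+ (a :+ (b :+ t)) := (a :+ b) :+ (a :+ b) :+ (t :+ t)) refl a b t ⟩
  (a ℤ.+ b) ℤ.+ (a ℤ.+ b) ℤ.+ (t ℤ.+ t)
    ≡⟨ cong₂ (λ d s → d ℤ.+ d ℤ.+ s) step rest ⟩
  signed c ℤ.-1ℤ ℤ.+ signed c ℤ.-1ℤ ℤ.+ signed c (ℤ.- + n)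
    ≡⟨ signed-even c n ⟩
  signed c (ℤ.- + (suc (suc n))) ∎
  where
  open ≡-Reasoning
  open ℤ.+-*-Solver
  c = colour p
  a = weight p
  b = weight (right p)
  t = total weight (segment (right (right p)) n)
  step : a ℤ.+ b ≡ signed c ℤ.-1ℤ
  step = trans (cong (λ q → a ℤ.+ signed q (ℤ.suc (proj₁ p))) (colour-right p)) (signed-step c (proj₁ p))
  rest : t ℤ.+ t ≡ signed c (ℤ.- + n)
  rest = trans (segment-weight (right (right p)) n e) (cong (λ q → signed q (ℤ.- + n)) (colour-right² p))

runs-weight : ∀ q {rs} → All (EvenRun q) rs →
  total weight (points rs) ℤ.+ total weight (points rs) ≡ signed q (ℤ.- + length (points rs))
runs-weight 0ℙ [] = refl
runs-weight 1ℙ [] = refl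
runs-weight q {(p , n) ∷ rs} ((e , c) ∷ es) = begin
  total weight (s ++ points rs) ℤ.+ total weight (s ++ points rs)
    ≡⟨ cong₂ ℤ._+_ (total-++ weight s) (total-++ weight s) ⟩
  (S ℤ.+ R) ℤ.+ (S ℤ.+ R)
    ≡⟨ solve 2 (λ S R → (S :+ R) :+ (S :+ R) := (S :+ S) :+ (R :+ R)) refl S R ⟩
  (S ℤ.+ S) ℤ.+ (R ℤ.+ R)
    ≡⟨ cong₂ ℤ._+_ (trans (segment-weight p n e) (cong (λ q → signed q (ℤ.- + n)) c)) (runs-weight q es) ⟩
  signed q (ℤ.- + n) ℤ.+ signed q (ℤ.- + m)
    ≡⟨ signed-+ q ⟩
  signed q (ℤ.- + (n ℕ.+ m))
    ≡⟨ cong (λ k → signed q (ℤ.- + k)) (sym (trans (length-++ s) (cong (ℕ._+ m) (length-segment p n)))) ⟩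
  signed q (ℤ.- + length (s ++ points rs)) ∎
  where
  open ≡-Reasoning
  open ℤ.+-*-Solver
  s = segment p n
  m = length (points rs)
  S = total weight s
  R = total weight (points rs)
  signed-+ : ∀ q → signed q (ℤ.- + n) ℤ.+ signed q (ℤ.- + m) ≡ signed q (ℤ.- + (n ℕ.+ m))
  signed-+ 0ℙ = sym (ℤ.neg-distrib-+ (+ n) (+ m))
  signed-+ 1ℙ = trans (cong₂ ℤ._+_ (ℤ.neg-involutive (+ n)) (ℤ.neg-involutive (+ m))) (sym (ℤ.neg-involutive (+ (n ℕ.+ m))))

-- Swapped, the segment is vertical: the abscissa is fixed and the signs alternate, so neighbours
-- cancel in pairs.
segment-swap-weight : ∀ p n → parity n ≡ 0ℙ → total (weight ∘ swap) (segment p n) ≡ ℤ.0ℤ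
segment-swap-weight p 0 e = refl
segment-swap-weight p (suc (suc n)) e = begin
  a ℤ.+ (b ℤ.+ t) ≡⟨ ℤ.+-assoc a b t ⟨
  a ℤ.+ b ℤ.+ t   ≡⟨ cong₂ ℤ._+_ cancel (segment-swap-weight (right (right p)) n e) ⟩
  ℤ.0ℤ            ∎
  where
  open ≡-Reasoning
  a = weight (swap p)
  b = weight (swap (right p))
  t = total (weight ∘ swap) (segment (right (right p)) n)
  cancel : a ℤ.+ b ≡ ℤ.0ℤ
  cancel = trans (cong (λ q → a ℤ.+ signed q (proj₂ p)) (colour-up (swap p))) (signed-pair (colour (swap p)) (proj₂ p))

Even : Run → Set
Even (p , n) = parity n ≡ 0ℙ

runs-swap-weight : ∀ {rs} → All Even rs → total (weight ∘ swap) (points rs) ≡ ℤ.0ℤ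
runs-swap-weight [] = refl
runs-swap-weight {(p , n) ∷ rs} (e ∷ es) = trans (total-++ (weight ∘ swap) (segment p n))
  (cong₂ ℤ._+_ (segment-swap-weight p n e) (runs-swap-weight es))

-- The even columns make the total weight vanish, while the rows make twice this total the
-- difference of the two lengths.
balance : ∀ {V as bs} → V ↭ points (as ++ bs) → All (EvenRun 0ℙ) as → All (EvenRun 1ℙ) bs →
          (C : Runs (map swap V)) → All Even (Runs.runs C) → length (points as) ≡ length (points bs)
balance {V} {as} {bs} perm eᵃ eᵇ C eᶜ = ℤ.+-injective (begin
  + m                                    ≡⟨ solve 2 (λ m n → m := n :- (:- m :+ n)) refl (+ m) (+ n) ⟩
  + n ℤ.- (ℤ.- + m ℤ.+ + n)              ≡⟨ cong (λ z → + n ℤ.- z) vanish ⟩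
  + n ℤ.- ℤ.0ℤ                           ≡⟨ ℤ.+-identityʳ (+ n) ⟩
  + n                                    ∎)
  where
  open ≡-Reasoning
  open ℤ.+-*-Solver
  m = length (points as)
  n = length (points bs)
  S = total weight (points as)
  T = total weight (points bs)
  null : S ℤ.+ T ≡ ℤ.0ℤ
  null = begin
    S ℤ.+ T                                ≡⟨ total-++ weight (points as) ⟨
    total weight (points as ++ points bs)  ≡⟨ cong (total weight) (points-++ as bs) ⟨
    total weight (points (as ++ bs))       ≡⟨ total-↭ weight perm ⟨
    total weight V                         ≡⟨ total-swap V ⟩
    total (weight ∘ swap) (map swap V)     ≡⟨ total-↭ (weight ∘ swap) (Runs.perm C) ⟩
    total (weight ∘ swap) (points (Runs.runs C)) ≡⟨ runs-swap-weight eᶜ ⟩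
    ℤ.0ℤ                                   ∎
  vanish : ℤ.- + m ℤ.+ + n ≡ ℤ.0ℤ
  vanish = begin
    ℤ.- + m ℤ.+ + n             ≡⟨ cong (ℤ._+_ (ℤ.- + m)) (ℤ.neg-involutive (+ n)) ⟨
    ℤ.- + m ℤ.+ ℤ.- (ℤ.- + n)   ≡⟨ cong₂ ℤ._+_ (runs-weight 0ℙ eᵃ) (runs-weight 1ℙ eᵇ) ⟨
    (S ℤ.+ S) ℤ.+ (T ℤ.+ T)     ≡⟨ solve 2 (λ S T → (S :+ S) :+ (T :+ T) := (S :+ T) :+ (S :+ T)) refl S T ⟩
    (S ℤ.+ T) ℤ.+ (S ℤ.+ T)     ≡⟨ cong₂ ℤ._+_ null null ⟩
    ℤ.0ℤ                        ∎

-- Existence of magic labellings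

unique⇒magic : ∀ {V} → Unique V → Magic V
unique⇒magic {V} V! = byRows (classify (Runs.runs rows))
  where
  rows : Runs V
  rows = decompose V!
  swapped! : Unique (map swap V)
  swapped! = Unique.map⁺ (cong swap) V!
  columns : Runs (map swap V)
  columns = decompose swapped!
  hasOdd : ∀ {W} → Unique W → (R : Runs W) → ∀ {as bs o os} → Runs.runs R ↭ as ++ bs ++ o ∷ os →
           All (EvenRun 0ℙ) as → All (EvenRun 1ℙ) bs → All OddRun (o ∷ os) → Magic W
  hasOdd W! R {as} {bs} {o} {os} perm eᵃ eᵇ (od ∷ ods) =
    -- One odd run is moved between the two kinds of even runs, where it switches the parity.
    arrangeable⇒magic W! (reorder R (↭-trans perm (++⁺ˡ as (shift o bs os)))) (odd-arrangeable eᵃ od eᵇ ods)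
  allEven : ∀ {rs as bs} → rs ↭ as ++ bs ++ [] → All (EvenRun 0ℙ) as → All (EvenRun 1ℙ) bs → All Even rs
  allEven perm eᵃ eᵇ = All-resp-↭ (↭-sym perm) (All.++⁺ (All.map proj₁ eᵃ) (All.++⁺ (All.map proj₁ eᵇ) []))
  byRows : Classified (Runs.runs rows) → Magic V
  byRows (classified {os = _ ∷ _} perm eᵃ eᵇ od) = hasOdd V! rows perm eᵃ eᵇ od
  byRows (classified {as} {bs} {[]} perm eᵃ eᵇ []) = byColumns (classify (Runs.runs columns))
    where
    perm′ : Runs.runs rows ↭ as ++ bs
    perm′ = ↭-trans perm (++⁺ˡ as (↭-reflexive (++-identityʳ bs)))
    arrangeable : ∀ {q rs} → All (EvenRun q) rs → Arrangeable q rs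
    arrangeable es = subst (Arrangeable _) (++-identityʳ _) (evens-arrangeable es [])
    byColumns : Classified (Runs.runs columns) → Magic V
    byColumns (classified {os = _ ∷ _} permᶜ eᶜ eᵈ od) = Magic-swap (hasOdd swapped! columns permᶜ eᶜ eᵈ od)
    byColumns (classified {os = []} permᶜ eᶜ eᵈ []) =
      -- No run is odd in either direction, so the columns force the two kinds of rows to balance.
      balanced⇒magic V! rows perm′ (arrangeable eᵃ) (arrangeable eᵇ)
        (balance (↭-trans (Runs.perm rows) (points-↭ perm′)) eᵃ eᵇ columns (allEven permᶜ eᶜ eᵈ))

-- Surjectivity by counting

-- The head of `xs` is removed from `ys`; by uniqueness the tail of `xs` still lies in what remains.
length-mono-⊆ : ∀ {A : Set} {xs ys : List A} → Unique xs → (∀ {x} → x ∈ xs → x ∈ ys) → length xs ≤ length ys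
length-mono-⊆ {xs = []} [] _ = z≤n
length-mono-⊆ {xs = x ∷ xs} (x≢ ∷ u) ⊆ys with zs , ys↭ ← extract (⊆ys (here refl)) =
  ℕ.≤-trans (s≤s (length-mono-⊆ u ⊆zs)) (ℕ.≤-reflexive (sym (↭-length ys↭)))
  where
  ⊆zs : ∀ {z} → z ∈ xs → z ∈ zs
  ⊆zs z∈ with ∈-resp-↭ ys↭ (⊆ys (there z∈))
  ... | here refl = contradiction refl (All.lookup x≢ z∈)
  ... | there z∈′ = z∈′

Unique-map : ∀ {A B : Set} {f : A → B} {xs} → (∀ {x y} → x ∈ xs → y ∈ xs → f x ≡ f y → x ≡ y) →
             Unique xs → Unique (map f xs)
Unique-map inj []       = []
Unique-map inj (x≢ ∷ u) =
  All.map⁺ (All.tabulate λ y∈ e → All.lookup x≢ y∈ (inj (here refl) (there y∈) e)) ∷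
  Unique-map (λ x∈ y∈ → inj (there x∈) (there y∈)) u

module _ {V} (V! : Unique V) (M : Magic V) where
  open Magic M

  -- A missing `k` together with the labels of `V` would be `length V + 1` distinct numbers between
  -- 1 and `length V`.
  label-onto : ∀ {k} → 1 ≤ k → k ≤ length V → ∃[ v ] (v ∈ V × k ≡ label v)
  label-onto {k} 1≤k k≤N with k ∈ℕ? map label V
  ... | yes k∈ = ∈-map⁻ label k∈
  ... | no  k∉ = contradiction too-long (ℕ.<-irrefl refl)
    where
    interval : List ℕ
    interval = applyUpTo suc (length V)
    ∈interval : ∀ {j} → 1 ≤ j → j ≤ length V → j ∈ interval
    ∈interval {suc j} _ j< = ∈-applyUpTo⁺ suc j<
    ⊆interval : ∀ {j} → j ∈ k ∷ map label V → j ∈ interval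
    ⊆interval (here refl) = ∈interval 1≤k k≤N
    ⊆interval (there j∈) with v , v∈ , refl ← ∈-map⁻ label j∈ = ∈interval (label-positive v∈) (label-bounded v∈)
    k∷! : Unique (k ∷ map label V)
    k∷! = All.¬Any⇒All¬ _ k∉ ∷ Unique-map label-injective V!
    too-long : length V < length V
    too-long = subst₂ (λ a b → suc a ≤ b) (length-map label V) (length-applyUpTo suc (length V))
                 (length-mono-⊆ k∷! ⊆interval)

-- Four-cycles of the square lattice

Adjacentℤ : ℤ → ℤ → Set
Adjacentℤ i j = j ≡ ℤ.suc i ⊎ i ≡ ℤ.suc j

data Step : Point → Point → Set where
  horizontal : ∀ {x x′ y} → Adjacentℤ x x′ → Step (x , y) (x′ , y)
  vertical   : ∀ {x y y′} → Adjacentℤ y y′ → Step (x , y) (x , y′)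

joins⇒step : ∀ {p q} e → Joins e p q → Step p q
joins⇒step (hor p) (inj₁ refl) = horizontal (inj₁ refl)
joins⇒step (hor p) (inj₂ refl) = horizontal (inj₂ refl)
joins⇒step (ver p) (inj₁ refl) = vertical (inj₁ refl)
joins⇒step (ver p) (inj₂ refl) = vertical (inj₂ refl)

<-suc : ∀ i → i ℤ.< ℤ.suc i
<-suc i = ℤ.suc[i]≤j⇒i<j ℤ.≤-refl

Adjacentℤ-irrefl : ∀ {i} → ¬ Adjacentℤ i i
Adjacentℤ-irrefl {i} (inj₁ e) = ℤ.<-irrefl e (<-suc i)
Adjacentℤ-irrefl {i} (inj₂ e) = ℤ.<-irrefl e (<-suc i)

Ascends : ℤ → ℤ → ℤ → Set
Ascends i j k = j ≡ ℤ.suc i × k ≡ ℤ.suc j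

ascends⇒< : ∀ {i j k} → Ascends i j k → i ℤ.< k
ascends⇒< (refl , refl) = ℤ.<-trans (<-suc _) (<-suc _)

monotone : ∀ {i j k} → Adjacentℤ i j → Adjacentℤ j k → i ≢ k → Ascends i j k ⊎ Ascends k j i
monotone (inj₁ e)    (inj₁ f)    i≢k = inj₁ (e , f)
monotone (inj₁ refl) (inj₂ f)    i≢k = contradiction (suc-injective f) i≢k
monotone (inj₂ refl) (inj₁ refl) i≢k = contradiction refl i≢k
monotone (inj₂ e)    (inj₂ f)    i≢k = inj₂ (f , e)

-- Two unit steps between distinct integers go in the same direction, so their intermediate point is
-- the midpoint.
midpoint-unique : ∀ {i j k l} → Adjacentℤ i j → Adjacentℤ j k → Adjacentℤ i l → Adjacentℤ l k → i ≢ k → j ≡ l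
midpoint-unique a b c d i≢k with monotone a b i≢k | monotone c d i≢k
... | inj₁ (refl , _) | inj₁ (refl , _) = refl
... | inj₂ (refl , _) | inj₂ (refl , _) = refl
... | inj₁ up         | inj₂ down       = contradiction (ascends⇒< down) (ℤ.<-asym (ascends⇒< up))
... | inj₂ down       | inj₁ up         = contradiction (ascends⇒< down) (ℤ.<-asym (ascends⇒< up))

-- The corners of a unit square in cyclic order. The primed coordinates may lie on either side,
-- which allows any starting corner; the constructors give the two senses of rotation.
data Square₄ : Point → Point → Point → Point → Set where
  square : ∀ {x y x′ y′} → Adjacentℤ x x′ → Adjacentℤ y y′ →
           Square₄ (x , y) (x′ , y) (x′ , y′) (x , y′)
  flipped : ∀ {x y x′ y′} → Adjacentℤ x x′ → Adjacentℤ y y′ →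
           Square₄ (x , y) (x , y′) (x′ , y′) (x′ , y)

-- Both `q` and `s` link `p` to `r` in two steps. If `p` and `r` were on one lattice line, both
-- would be the midpoint; hence `p` and `r` are diagonally opposite, and `q` and `s` are the other
-- two corners.
four-cycle : ∀ {p q r s} → Step p q → Step q r → Step p s → Step s r → p ≢ r → q ≢ s → Square₄ p q r s
four-cycle (horizontal a) (horizontal b) (horizontal c) (horizontal d) p≢r q≢s =
  contradiction (cong (_, _) (midpoint-unique a b c d (p≢r ∘ cong (_, _)))) q≢s
four-cycle (horizontal a) (horizontal b) (vertical c)   (horizontal d) p≢r q≢s = contradiction c Adjacentℤ-irrefl
four-cycle (horizontal a) (horizontal b) (horizontal c) (vertical d)   p≢r q≢s = contradiction d Adjacentℤ-irrefl
four-cycle (horizontal a) (horizontal b) (vertical c)   (vertical d)   p≢r q≢s = contradiction refl p≢r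
four-cycle (vertical a)   (vertical b)   (vertical c)   (vertical d)   p≢r q≢s =
  contradiction (cong (_ ,_) (midpoint-unique a b c d (p≢r ∘ cong (_ ,_)))) q≢s
four-cycle (vertical a)   (vertical b)   (horizontal c) (vertical d)   p≢r q≢s = contradiction c Adjacentℤ-irrefl
four-cycle (vertical a)   (vertical b)   (vertical c)   (horizontal d) p≢r q≢s = contradiction d Adjacentℤ-irrefl
four-cycle (vertical a)   (vertical b)   (horizontal c) (horizontal d) p≢r q≢s = contradiction refl p≢r
four-cycle (horizontal a) (vertical b)   (horizontal c) (horizontal d) p≢r q≢s = contradiction b Adjacentℤ-irrefl
four-cycle (horizontal a) (vertical b)   (vertical c)   (vertical d)   p≢r q≢s = contradiction a Adjacentℤ-irrefl
four-cycle (horizontal a) (vertical b)   (horizontal c) (vertical d)   p≢r q≢s = contradiction refl q≢s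
four-cycle (horizontal a) (vertical b)   (vertical c)   (horizontal d) p≢r q≢s = square a b
four-cycle (vertical a)   (horizontal b) (horizontal c) (horizontal d) p≢r q≢s = contradiction a Adjacentℤ-irrefl
four-cycle (vertical a)   (horizontal b) (vertical c)   (vertical d)   p≢r q≢s = contradiction b Adjacentℤ-irrefl
four-cycle (vertical a)   (horizontal b) (vertical c)   (horizontal d) p≢r q≢s = contradiction refl q≢s
four-cycle (vertical a)   (horizontal b) (horizontal c) (vertical d)   p≢r q≢s = flipped b a

module _ {V} (M : Magic V) where
  open Magic M
  open ℕ.+-*-Solver

  -- The choice of sides only decides which corner is the lower left one.
  rectangle-sum : ∀ {x y x′ y′} → Adjacentℤ x x′ → Adjacentℤ y y′ →
    (x , y) ∈ V → (x′ , y) ∈ V → (x , y′) ∈ V → (x′ , y′) ∈ V →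
    label (x , y) ℕ.+ label (x′ , y) ℕ.+ (label (x , y′) ℕ.+ label (x′ , y′)) ≡ constant
  rectangle-sum (inj₁ refl) (inj₁ refl) a b c d = square-sum _ a b c d
  rectangle-sum (inj₂ refl) (inj₁ refl) a b c d = trans
    (solve 4 (λ a b c d → a :+ b :+ (c :+ d) := b :+ a :+ (d :+ c)) refl (label _) (label _) (label _) (label _))
    (square-sum _ b a d c)
  rectangle-sum (inj₁ refl) (inj₂ refl) a b c d = trans
    (solve 4 (λ a b c d → a :+ b :+ (c :+ d) := c :+ d :+ (a :+ b)) refl (label _) (label _) (label _) (label _))
    (square-sum _ c d a b)
  rectangle-sum (inj₂ refl) (inj₂ refl) a b c d = trans
    (solve 4 (λ a b c d → a :+ b :+ (c :+ d) := d :+ c :+ (b :+ a)) refl (label _) (label _) (label _) (label _))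
    (square-sum _ d c b a)

  -- The left-hand side is the form to which the `sum` over a tabulated 4-cycle reduces.
  cycle-sum : ∀ {p q r s} → Square₄ p q r s → p ∈ V → q ∈ V → r ∈ V → s ∈ V →
    label p ℕ.+ (label q ℕ.+ (label r ℕ.+ (label s ℕ.+ 0))) ≡ constant
  cycle-sum (square h v) a b c d = trans
    (solve 4 (λ a b c d → a :+ (b :+ (c :+ (d :+ con 0))) := a :+ b :+ (d :+ c)) refl (label _) (label _) (label _) (label _))
    (rectangle-sum h v a b d c)
  cycle-sum (flipped h v) a b c d = trans
    (solve 4 (λ a b c d → a :+ (b :+ (c :+ (d :+ con 0))) := a :+ d :+ (b :+ c)) refl (label _) (label _) (label _) (label _))
    (rectangle-sum h v a d b c)

-- From labellings of points to polyominoes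

theorem4 : (P : Polyomino) → C[ 4 ]-FaceMagic P
theorem4 P = mk⤖ {to = to} (to-injective , to-surjective) , constant , face-sum
  where
  V! : Unique (vertices P)
  V! = deduplicate-! _
  open Magic (unique⇒magic V!)
  -- The membership proof stored in a vertex is irrelevant; decidability recovers it.
  member : (v : Vertex P) → value v ∈ vertices P
  member (v , [ v∈ ]) = recompute (v ∈? vertices P) v∈
  to : Vertex P → Label ∣V P ∣
  to v = label (value v) , [ label-positive (member v) , label-bounded (member v) ]
  to-injective : ∀ {v w} → to v ≡ to w → v ≡ w
  to-injective {v} {w} e = value-injective (label-injective (member v) (member w) (cong value e))
  to-surjective : ∀ k → ∃[ v ] (∀ {w} → w ≡ v → to w ≡ k)
  to-surjective (k , [ k∈ ])
    with v , v∈ , e ← label-onto V! (unique⇒magic V!)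
           (recompute (1 ℕ.≤? k) (proj₁ k∈)) (recompute (k ℕ.≤? ∣V P ∣) (proj₂ k∈)) =
    (v , [ v∈ ]) , λ where refl → value-injective (sym e)
  face-sum : ∀ s (γ : Fin 4 → Vertex P) → BoundedBy P s 4 γ → sum (tabulate (λ i → value (to (γ i)))) ≡ constant
  face-sum s γ bounded = cycle-sum (unique⇒magic V!)
    -- Vertex 0 reaches vertex 2 through vertex 1 and, against the direction of the cycle, through
    -- vertex 3.
    (four-cycle (forward 0F) (forward 1F) (backward 3F) (backward 2F) (distinct λ ()) (distinct λ ()))
    (member (γ 0F)) (member (γ 1F)) (member (γ 2F)) (member (γ 3F))
    where
    open IsCycle (BoundedBy.isCycle bounded)
    forward : ∀ i → Step (value (γ i)) (value (γ (next i)))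
    forward i = let (e , _ , joins) = adjacent i in joins⇒step e joins
    backward : ∀ i → Step (value (γ (next i))) (value (γ i))
    backward i = let (e , _ , joins) = adjacent i in joins⇒step e (Sum.swap joins)
    distinct : ∀ {i j} → i ≢ j → value (γ i) ≢ value (γ j)
    distinct i≢j e = i≢j (injective (value-injective e))
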